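{- Let $q$ be an odd prime power, let $u\in\mathbb{F}_q$ be a quadratic non-residue in $\mathbb{F}_q$, and let $\alpha\in\mathbb{F}_{q^2}$ satisfy $\alpha^2=u$. Let $\gamma\in\mathbb{F}_{q^2}$. The polynomial $f(x)=x+\gamma\,\mathrm{Tr}\left(x^2+x^{q+1}\right)$ over $\mathbb{F}_{q^2}$ is a permutation polynomial if and only if $\alpha\gamma\in\mathbb{F}_q$.
   Context: $\mathrm{Tr}:\mathbb{F}_{q^2}\to\mathbb{F}_q$ is the trace map $\mathrm{Tr}(x)=x+x^q$. A polynomial $f$ over $\mathbb{F}_{q^2}$ is a permutation polynomial if the map $x\mapsto f(x)$ is a bijection of $\mathbb{F}_{q^2}$ onto itself. -}

module Defs where

open import Algebra.Apartness.Bundles using (HeytingField; module HeytingCommutativeRing)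
open import Algebra.Bundles using (CommutativeRing)
open import Algebra.Bundles.Raw using (RawSemiring; module RawRing)
open import Algebra.Morphism.Structures using (IsRingMonomorphism)
import Algebra.Definitions.RawSemiring as Power
import Algebra.Properties.Semiring.Exp as Exp
import Algebra.Properties.CommutativeSemigroup as CommutativeSemigroupProperties
open import Data.Fin.Base using (Fin)
open import Data.List.Base using (List; []; _∷_; map)
open import Data.Nat.Base as ℕ using (ℕ; zero; suc; NonZero)
open import Data.Nat.Divisibility using (_∣_)
open import Data.Nat.Primality using (Prime)
open import Data.Product.Base using (_×_; ∃; ∃₂)
open import Function.Bundles using (Inverse)
open import Function.Definitions using (Bijective)
open import Level using (Level; _⊔_) renaming (suc to lsuc)
open import Relation.Binary.PropositionalEquality.Core using (_≡_)
import Relation.Binary.PropositionalEquality.Properties as ≡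
import Relation.Binary.Reasoning.Setoid as SetoidReasoning
open import Relation.Nullary.Negation using (¬_)

private
  variable
    a ℓ c₁ ℓ₁ ℓ₁′ c₂ ℓ₂ ℓ₂′ : Level

PrimePower : ℕ → Set
PrimePower q = ∃₂ λ p k → Prime p × NonZero k × q ≡ p ℕ.^ k

OddPrimePower : ℕ → Set
OddPrimePower q = PrimePower q × ¬ (2 ∣ q)

-- Stated for raw semirings so that it applies both to elements of a ring
-- and to polynomials over it.
Tr : (S : RawSemiring a ℓ) → ℕ → RawSemiring.Carrier S → RawSemiring.Carrier S
Tr S q x = x + x ^ q
  where
  open RawSemiring S
  open Power S using (_^_)

module Polynomials (R : CommutativeRing a ℓ) where

  open CommutativeRing R
  open Exp semiring using (_^_)

  -- Coefficients are listed from the constant term upwards, and trailing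
  -- zeros are allowed: polynomials are equal when all coefficients are (_≈ₚ_).
  Poly : Set a
  Poly = List Carrier

  coeff : Poly → ℕ → Carrier
  coeff []      _       = 0#
  coeff (c ∷ _) zero    = c
  coeff (_ ∷ p) (suc n) = coeff p n

  _≈ₚ_ : Poly → Poly → Set ℓ
  p ≈ₚ r = ∀ n → coeff p n ≈ coeff r n

  infixl 6 _+ₚ_
  infixl 7 _*ₚ_

  _+ₚ_ : Poly → Poly → Poly
  []      +ₚ r       = r
  (c ∷ p) +ₚ []      = c ∷ p
  (c ∷ p) +ₚ (d ∷ r) = c + d ∷ (p +ₚ r)

  _*ₚ_ : Poly → Poly → Poly
  []      *ₚ r = []
  (c ∷ p) *ₚ r = map (c *_) r +ₚ (0# ∷ p *ₚ r)

  C : Carrier → Poly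
  C c = c ∷ []

  X : Poly
  X = 0# ∷ 1# ∷ []

  R[X] : RawSemiring a ℓ
  R[X] = record
    { Carrier = Poly
    ; _≈_     = _≈ₚ_
    ; _+_     = _+ₚ_
    ; _*_     = _*ₚ_
    ; 0#      = []
    ; 1#      = C 1#
    }

  open Power R[X] public using () renaming (_^_ to _^ₚ_)

  eval : Poly → Carrier → Carrier
  eval []      x = 0#
  eval (c ∷ p) x = c + x * eval p x

  IsPermutationPolynomial : Poly → Set (a ⊔ ℓ)
  IsPermutationPolynomial p = Bijective _≈_ _≈_ (eval p)

  open SetoidReasoning setoid
  private
    module +-CS = CommutativeSemigroupProperties +-commutativeSemigroup
    module *-CS = CommutativeSemigroupProperties *-commutativeSemigroup

  eval-+ : ∀ p r x → eval (p +ₚ r) x ≈ eval p x + eval r x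
  eval-+ []      r       x = sym (+-identityˡ _)
  eval-+ (c ∷ p) []      x = sym (+-identityʳ _)
  eval-+ (c ∷ p) (d ∷ r) x = begin
    (c + d) + x * eval (p +ₚ r) x            ≈⟨ +-congˡ (*-congˡ (eval-+ p r x)) ⟩
    (c + d) + x * (eval p x + eval r x)      ≈⟨ +-congˡ (distribˡ x _ _) ⟩
    (c + d) + (x * eval p x + x * eval r x)  ≈⟨ +-CS.interchange c d _ _ ⟩
    (c + x * eval p x) + (d + x * eval r x)  ∎

  eval-map : ∀ c r x → eval (map (c *_) r) x ≈ c * eval r x
  eval-map c []      x = sym (zeroʳ c)
  eval-map c (d ∷ r) x = begin
    c * d + x * eval (map (c *_) r) x  ≈⟨ +-congˡ (*-congˡ (eval-map c r x)) ⟩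
    c * d + x * (c * eval r x)         ≈⟨ +-congˡ (*-CS.x∙yz≈y∙xz x c _) ⟩
    c * d + c * (x * eval r x)         ≈⟨ distribˡ c d _ ⟨
    c * (d + x * eval r x)             ∎

  eval-* : ∀ p r x → eval (p *ₚ r) x ≈ eval p x * eval r x
  eval-* []      r x = sym (zeroˡ _)
  eval-* (c ∷ p) r x = begin
    eval (map (c *_) r +ₚ (0# ∷ p *ₚ r)) x
      ≈⟨ eval-+ (map (c *_) r) _ x ⟩
    eval (map (c *_) r) x + (0# + x * eval (p *ₚ r) x)
      ≈⟨ +-cong (eval-map c r x) (+-identityˡ _) ⟩
    c * eval r x + x * eval (p *ₚ r) x
      ≈⟨ +-congˡ (*-congˡ (eval-* p r x)) ⟩
    c * eval r x + x * (eval p x * eval r x)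
      ≈⟨ +-congˡ (*-assoc x _ _) ⟨
    c * eval r x + x * eval p x * eval r x
      ≈⟨ distribʳ (eval r x) c _ ⟨
    (c + x * eval p x) * eval r x
      ∎

  eval-C : ∀ c x → eval (C c) x ≈ c
  eval-C c x = trans (+-congˡ (zeroʳ x)) (+-identityʳ c)

  eval-X : ∀ x → eval X x ≈ x
  eval-X x = trans (+-identityˡ _) (trans (*-congˡ (eval-C 1# x)) (*-identityʳ x))

  eval-^ : ∀ p n x → eval (p ^ₚ n) x ≈ eval p x ^ n
  eval-^ p zero    x = eval-C 1# x
  eval-^ p (suc n) x = trans (eval-* p (p ^ₚ n) x) (*-congˡ (eval-^ p n x))

module _ (F : HeytingField c₁ ℓ₁ ℓ₁′) where

  fieldCommutativeRing : CommutativeRing c₁ ℓ₁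
  fieldCommutativeRing =
    HeytingCommutativeRing.commutativeRing (HeytingField.heytingCommutativeRing F)

  private module F = CommutativeRing fieldCommutativeRing
  open Exp F.semiring using (_^_)

  -- A Heyting field with a finite carrier is an ordinary field: equality is
  -- decidable, so every element not equal to zero has an inverse.
  HasOrder : ℕ → Set (c₁ ⊔ ℓ₁)
  HasOrder n = Inverse F.setoid (≡.setoid (Fin n))

  -- Zero is a square, so a non-residue is automatically nonzero.
  QuadraticNonResidue : F.Carrier → Set (c₁ ⊔ ℓ₁)
  QuadraticNonResidue u = ¬ (∃ λ y → y ^ 2 F.≈ u)

-- 𝔽_q as a subfield of 𝔽_{q²}, the inclusion being the embedding ι.
record QuadraticExtension (q : ℕ) (c₁ ℓ₁ ℓ₁′ c₂ ℓ₂ ℓ₂′ : Level)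
       : Set (lsuc (c₁ ⊔ ℓ₁ ⊔ ℓ₁′ ⊔ c₂ ⊔ ℓ₂ ⊔ ℓ₂′)) where
  field
    𝔽q  : HeytingField c₁ ℓ₁ ℓ₁′
    𝔽q² : HeytingField c₂ ℓ₂ ℓ₂′
    𝔽q-order  : HasOrder 𝔽q q
    𝔽q²-order : HasOrder 𝔽q² (q ℕ.^ 2)

  module 𝔽q  = CommutativeRing (fieldCommutativeRing 𝔽q)
  module 𝔽q² = CommutativeRing (fieldCommutativeRing 𝔽q²)

  field
    ι      : 𝔽q.Carrier → 𝔽q².Carrier
    ι-mono : IsRingMonomorphism 𝔽q.rawRing 𝔽q².rawRing ι

  infix 4 _∈𝔽q

  _∈𝔽q : 𝔽q².Carrier → Set (c₁ ⊔ ℓ₂)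
  y ∈𝔽q = ∃ λ x → ι x 𝔽q².≈ y

  open 𝔽q² using (_≈_; _+_; _*_)
  open Exp 𝔽q².semiring public using (_^_; ^-congˡ)
  open Polynomials (fieldCommutativeRing 𝔽q²) public

  -- X + γ Tr(X² + X^(q+1)) as an element of 𝔽_{q²}[X].
  f : 𝔽q².Carrier → Poly
  f γ = X +ₚ C γ *ₚ Tr R[X] q (X ^ₚ 2 +ₚ X ^ₚ (q ℕ.+ 1))

  eval-f : ∀ γ x → eval (f γ) x ≈ x + γ * Tr (RawRing.rawSemiring 𝔽q².rawRing) q (x ^ 2 + x ^ (q ℕ.+ 1))
  eval-f γ x = begin
    eval (X +ₚ C γ *ₚ Tr R[X] q s) x
      ≈⟨ eval-+ X (C γ *ₚ Tr R[X] q s) x ⟩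
    eval X x + eval (C γ *ₚ Tr R[X] q s) x
      ≈⟨ 𝔽q².+-cong (eval-X x) (eval-* (C γ) (Tr R[X] q s) x) ⟩
    x + eval (C γ) x * eval (Tr R[X] q s) x
      ≈⟨ 𝔽q².+-congˡ (𝔽q².*-cong (eval-C γ x) (eval-+ s (s ^ₚ q) x)) ⟩
    x + γ * (eval s x + eval (s ^ₚ q) x)
      ≈⟨ 𝔽q².+-congˡ (𝔽q².*-congˡ (𝔽q².+-cong eval-s
           (𝔽q².trans (eval-^ s q x) (^-congˡ q eval-s)))) ⟩
    x + γ * Tr (RawRing.rawSemiring 𝔽q².rawRing) q (x ^ 2 + x ^ (q ℕ.+ 1))
      ∎
    where
    open SetoidReasoning 𝔽q².setoid

    s : Poly
    s = X ^ₚ 2 +ₚ X ^ₚ (q ℕ.+ 1)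

    eval-X^ : ∀ n → eval (X ^ₚ n) x ≈ x ^ n
    eval-X^ n = 𝔽q².trans (eval-^ X n x) (^-congˡ n (eval-X x))

    eval-s : eval s x ≈ x ^ 2 + x ^ (q ℕ.+ 1)
    eval-s = 𝔽q².trans (eval-+ (X ^ₚ 2) (X ^ₚ (q ℕ.+ 1)) x) (𝔽q².+-cong (eval-X^ 2) (eval-X^ (q ℕ.+ 1)))

{-# OPTIONS --safe #-}

-- Write x̄ = x^q and T(x) = x + x̄, so that f(x) = x + γ T(x)². The map f is
-- bijective iff T(γ) = 0: if T(γ) = 0 then T(f(x)) = T(x), so x is recovered as
-- f(x) − γ T(f(x))², and if t = T(γ) ≠ 0 then f(−γ/t²) = 0 = f(0). Since u is
-- not a square in 𝔽q, α is not in 𝔽q and ᾱ = −α, so T(γ) = 0 iff αγ is fixed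
-- by x ↦ x̄, i.e. iff αγ ∈ 𝔽q.
--
-- That x ↦ x̄ is additive with fixed field 𝔽q follows, without the binomial
-- theorem, from x^q − x = ∏_{a ∈ 𝔽q} (x − a): the product is invariant under
-- x ↦ x + 1, so (x + 1)^q = x^q + 1, and one rescales.
module Submission where

open import Defs
open import Algebra.Apartness.Bundles using (HeytingField)
import Algebra.Apartness.Properties.HeytingCommutativeRing as HeytingProperties
open import Algebra.Bundles using (CommutativeMonoid; CommutativeRing)
open import Algebra.Morphism.Structures using (IsRingMonomorphism)
import Algebra.Properties.CommutativeMonoid.Sum as Sum
import Algebra.Properties.CommutativeSemiring.Exp as Exp
import Algebra.Properties.Ring as RingProperties
import Algebra.Solver.Ring.NaturalCoefficients.Default as SemiringSolver
open import Data.Empty using (⊥-elim)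
open import Data.Fin.Base using (Fin; zero; suc; punchIn)
import Data.Fin.Properties as Fin
open import Data.Nat.Base as ℕ using (ℕ; zero; suc)
import Data.Nat.Properties as ℕ
open import Data.Product.Base using (∃; _,_; proj₁; proj₂)
open import Data.Vec.Base using (Vec; []; _∷_; replicate)
open import Data.Vec.Functional using (Vector)
open import Function.Base using (_∘_)
open import Function.Bundles using (_⇔_; Inverse; mk⇔)
import Function.Construct.Composition as Composition
import Function.Construct.Symmetry as Symmetry
open import Function.Properties.Inverse using (Inverse⇒Injection)
open import Level using (Level)
open import Relation.Binary.Bundles using (Setoid)
open import Relation.Binary.Definitions using (Decidable)
open import Relation.Binary.PropositionalEquality.Core as ≡ using (_≡_)
import Relation.Binary.PropositionalEquality.Properties as ≡
import Relation.Binary.Reasoning.Setoid as SetoidReasoning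
open import Relation.Nullary using (¬_; Dec; yes; no)
open import Relation.Nullary.Decidable using (via-injection; decidable-stable; map′)

private
  variable
    a ℓ c c′ ℓ′ : Level

-- Reindexing sums over an enumerated finite setoid.

module _ {S : Setoid c ℓ} {n : ℕ} (enum : Inverse S (≡.setoid (Fin n)))
         (M : CommutativeMonoid c′ ℓ′) where

  private
    module S = Setoid S
    module M = CommutativeMonoid M
    open Inverse enum using (from; strictlyInverseʳ)
    open Sum M using (sum; sum-permute; sum-cong-≋)

  -- Conjugating `π` by the enumeration gives a permutation of `Fin n`. Its use below is with
  -- multiplicative monoids, where `sum` is a product over all elements of a finite field.
  sum-reindex : (φ : S.Carrier → M.Carrier) → (∀ {x y} → x S.≈ y → φ x M.≈ φ y) →
                (π : Inverse S S) → sum (φ ∘ from) M.≈ sum (φ ∘ Inverse.to π ∘ from)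
  sum-reindex φ φ-cong π = M.trans
    (sum-permute (φ ∘ from)
      (Composition.inverse (Symmetry.inverse enum) (Composition.inverse π enum)))
    (sum-cong-≋ λ i → φ-cong (strictlyInverseʳ (Inverse.to π (from i))))

-- Monic polynomials over a domain and their splitting at known roots.

NoZeroDivisors : CommutativeRing a ℓ → Set _
NoZeroDivisors R = ∀ {x y} → x * y ≈ 0# → ¬ x ≈ 0# → y ≈ 0#
  where open CommutativeRing R

module MonicPolynomials (R : CommutativeRing a ℓ) (noZeroDivisors : NoZeroDivisors R) where

  open CommutativeRing R hiding (zero)
  open Exp commutativeSemiring using (_^_)
  open RingProperties ring
  open SetoidReasoning setoid
  open SemiringSolver commutativeSemiring using (solve; _:+_; _:*_; _:=_)
  open Sum *-commutativeMonoid using () renaming (sum to product)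

  -- The coefficients are those below the leading 1, from the constant term up.
  monic : ∀ {n} → Vec Carrier n → Carrier → Carrier
  monic []       x = 1#
  monic (c ∷ cs) x = c + x * monic cs x

  infixl 7 _÷_

  -- The quotient on division by `x - b`, computed by Horner's scheme: its coefficients are the
  -- values at `b` of the successive tails of the dividend, and the leading 1 stays implicit.
  _÷_ : ∀ {n} → Vec Carrier (suc n) → Carrier → Vec Carrier n
  (c ∷ [])     ÷ b = []
  (c ∷ d ∷ ds) ÷ b = monic (d ∷ ds) b ∷ (d ∷ ds) ÷ b

  monic-÷ : ∀ {n} (cs : Vec Carrier (suc n)) b x →
            monic cs x ≈ monic cs b + (x - b) * monic (cs ÷ b) x
  monic-÷ (c ∷ []) b x = begin
    -- The semiring solver has no subtraction, so `x` is rewritten as `x - b + b` and `x - b` is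
    -- treated as an atom.
    c + x * 1#                   ≈⟨ +-congˡ (*-congʳ (//-rightDividesˡ b x)) ⟨
    c + (x - b + b) * 1#
      ≈⟨ solve 4 (λ c b d e → c :+ (d :+ b) :* e := c :+ b :* e :+ d :* e) refl c b (x - b) 1# ⟩
    c + b * 1# + (x - b) * 1#    ∎
  monic-÷ (c ∷ cs@(_ ∷ _)) b x = begin
    c + x * monic cs x                            ≈⟨ +-congˡ (*-congˡ (monic-÷ cs b x)) ⟩
    c + x * (A + d * B)                           ≈⟨ +-congˡ (*-congʳ (//-rightDividesˡ b x)) ⟨
    c + (d + b) * (A + d * B)
      ≈⟨ solve 5 (λ c d b A B → c :+ (d :+ b) :* (A :+ d :* B) :=
                                c :+ b :* A :+ d :* (A :+ (d :+ b) :* B)) refl c d b A B ⟩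
    c + b * A + d * (A + (d + b) * B)
      ≈⟨ +-congˡ (*-congˡ (+-congˡ (*-congʳ (//-rightDividesˡ b x)))) ⟩
    c + b * A + d * (A + x * B)                   ∎
    where
    d = x - b
    A = monic cs b
    B = monic (cs ÷ b) x

  -- Induction on the degree: `r zero` splits off with remainder zero, and the other roots, being
  -- different from it, are roots of the quotient because there are no zero divisors. With as many
  -- roots as the degree, the last quotient is 1.
  monic-split : ∀ {n} (cs : Vec Carrier n) (r : Vector Carrier n) →
                (∀ {i j} → r i ≈ r j → i ≡ j) → (∀ i → monic cs (r i) ≈ 0#) →
                ∀ x → monic cs x ≈ product (λ i → x - r i)
  monic-split {zero}  []         r r-inj root x = refl
  monic-split {suc n} cs@(_ ∷ _) r r-inj root x = begin
    monic cs x                                      ≈⟨ factor x ⟩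
    (x - r zero) * monic (cs ÷ r zero) x            ≈⟨ *-congˡ
      (monic-split (cs ÷ r zero) (r ∘ suc) (Fin.suc-injective ∘ r-inj) root′ x) ⟩
    (x - r zero) * product (λ i → x - r (suc i))    ∎
    where
    factor : ∀ y → monic cs y ≈ (y - r zero) * monic (cs ÷ r zero) y
    factor y = trans (monic-÷ cs (r zero) y) (trans (+-congʳ (root zero)) (+-identityˡ _))

    root′ : ∀ i → monic (cs ÷ r zero) (r (suc i)) ≈ 0#
    root′ i = noZeroDivisors (trans (sym (factor (r (suc i)))) (root (suc i)))
      λ eq → Fin.0≢1+n (≡.sym (r-inj (x∙y⁻¹≈ε⇒x≈y _ _ eq)))

  monic-0s : ∀ n x → monic (replicate n 0#) x ≈ x ^ n
  monic-0s zero    x = refl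
  monic-0s (suc n) x = trans (+-identityˡ _) (*-congˡ (monic-0s n x))

  -- The degree has the form `2 + n` so that the coefficient `- 1#` of `x` lies below the leading 1.
  monic-x^n-x : ∀ n x → monic (0# ∷ - 1# ∷ replicate n 0#) x ≈ x ^ (2 ℕ.+ n) - x
  monic-x^n-x n x = begin
    0# + x * (- 1# + x * monic (replicate n 0#) x)  ≈⟨ +-identityˡ _ ⟩
    x * (- 1# + x * monic (replicate n 0#) x)       ≈⟨ *-congˡ (+-congˡ (*-congˡ (monic-0s n x))) ⟩
    x * (- 1# + x ^ (1 ℕ.+ n))                      ≈⟨ distribˡ x _ _ ⟩
    x * - 1# + x ^ (2 ℕ.+ n)                        ≈⟨ +-congʳ (-‿distribʳ-* x 1#) ⟨
    - (x * 1#) + x ^ (2 ℕ.+ n)                      ≈⟨ +-congʳ (-‿cong (*-identityʳ x)) ⟩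
    - x + x ^ (2 ℕ.+ n)                             ≈⟨ +-comm _ _ ⟩
    x ^ (2 ℕ.+ n) - x                               ∎

  x^n-x-split : ∀ {n} → 2 ℕ.≤ n → (r : Vector Carrier n) →
                (∀ {i j} → r i ≈ r j → i ≡ j) → (∀ i → r i ^ n ≈ r i) →
                ∀ x → x ^ n - x ≈ product (λ i → x - r i)
  x^n-x-split (ℕ.s≤s (ℕ.s≤s {n = n} ℕ.z≤n)) r r-inj r^n≈r x =
    trans (sym (monic-x^n-x n x))
      (monic-split (0# ∷ - 1# ∷ replicate n 0#) r r-inj
        (λ i → trans (monic-x^n-x n (r i)) (x≈y⇒x∙y⁻¹≈ε (r^n≈r i))) x)

-- Finite fields: decidable equality, inverses and Fermat's little theorem.

module FiniteField (F : HeytingField c ℓ ℓ′) {n : ℕ} (order : HasOrder F n) where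

  private
    module H = HeytingField F
    module HP = HeytingProperties H.heytingCommutativeRing

  open CommutativeRing (fieldCommutativeRing F) hiding (zero)
  open Exp commutativeSemiring using (_^_)
  open SetoidReasoning setoid
  open Inverse order using (to; from; to-cong; strictlyInverseˡ; strictlyInverseʳ)
  open Sum *-commutativeMonoid
    using (sum-cong-≋; sum-replicate; ∑-distrib-+; sum-remove)
    renaming (sum to product)

  infix 4 _≟_

  _≟_ : Decidable _≈_
  _≟_ = via-injection (Inverse⇒Injection order) Fin._≟_

  1≉0 : ¬ 1# ≈ 0#
  1≉0 1≈0 = proj₂ (H.tight 1# 0#) 1≈0 HP.1#0

  -- Apartness from 0 only follows from x ≉ 0 up to double negation; having an
  -- inverse is decidable by search.
  inverse : ∀ x → ¬ x ≈ 0# → ∃ λ y → x * y ≈ 1#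
  inverse x x≉0 = decidable-stable inverse? λ ¬inv →
    x≉0 (proj₁ (H.tight x 0#) λ x#0 →
      let y , _ , eq = H.#⇒invertible x#0 in
      ¬inv (y , trans (*-congʳ (sym (HP.x-0≈x x))) eq))
    where
    inverse? : Dec (∃ λ y → x * y ≈ 1#)
    inverse? = map′ (λ (i , eq) → from i , eq)
                    (λ (y , eq) → to y , trans (*-congˡ (strictlyInverseʳ y)) eq)
                    (Fin.any? λ i → x * from i ≟ 1#)

  noZeroDivisors : NoZeroDivisors (fieldCommutativeRing F)
  noZeroDivisors {x} {y} xy≈0 x≉0 = let x⁻¹ , xx⁻¹≈1 = inverse x x≉0 in begin
    y              ≈⟨ *-identityˡ y ⟨
    1# * y         ≈⟨ *-congʳ xx⁻¹≈1 ⟨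
    x * x⁻¹ * y    ≈⟨ *-congʳ (*-comm x x⁻¹) ⟩
    x⁻¹ * x * y    ≈⟨ *-assoc x⁻¹ x y ⟩
    x⁻¹ * (x * y)  ≈⟨ *-congˡ xy≈0 ⟩
    x⁻¹ * 0#       ≈⟨ zeroʳ x⁻¹ ⟩
    0#             ∎

  product≈0⇒∃≈0 : ∀ {m} (t : Vector Carrier m) → product t ≈ 0# → ∃ λ i → t i ≈ 0#
  product≈0⇒∃≈0 {zero}  t eq = ⊥-elim (1≉0 eq)
  product≈0⇒∃≈0 {suc m} t eq with t zero ≟ 0#
  ... | yes t₀≈0 = zero , t₀≈0
  ... | no  t₀≉0 = let i , tᵢ≈0 = product≈0⇒∃≈0 (t ∘ suc) (noZeroDivisors eq t₀≉0) in
                   suc i , tᵢ≈0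

  2≤order : 2 ℕ.≤ n
  2≤order = distinct⇒2≤ (to 1#) (to 0#) λ eq → 1≉0 (begin
    1#            ≈⟨ strictlyInverseʳ 1# ⟨
    from (to 1#)  ≡⟨ ≡.cong from eq ⟩
    from (to 0#)  ≈⟨ strictlyInverseʳ 0# ⟩
    0#            ∎)
    where
    distinct⇒2≤ : ∀ {k} (i j : Fin k) → ¬ i ≡ j → 2 ℕ.≤ k
    distinct⇒2≤ {suc zero}    zero zero i≢j = ⊥-elim (i≢j ≡.refl)
    distinct⇒2≤ {suc (suc k)} _    _    _   = ℕ.s≤s (ℕ.s≤s ℕ.z≤n)

  -- With `d` equal to 1, a product of such values over the whole field is a product over its
  -- nonzero elements.
  caseZero : Carrier → Carrier → Carrier → Carrier
  caseZero d v x with x ≟ 0#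
  ... | yes _ = d
  ... | no  _ = v

  caseZero-≈0 : ∀ d v {x} → x ≈ 0# → caseZero d v x ≈ d
  caseZero-≈0 d v {x} x≈0 with x ≟ 0#
  ... | yes _   = refl
  ... | no  x≉0 = ⊥-elim (x≉0 x≈0)

  caseZero-≉0 : ∀ d v {x} → ¬ x ≈ 0# → caseZero d v x ≈ v
  caseZero-≉0 d v {x} x≉0 with x ≟ 0#
  ... | yes x≈0 = ⊥-elim (x≉0 x≈0)
  ... | no  _   = refl

  *-inverse : ∀ x y → x * y ≈ 1# → Inverse setoid setoid
  *-inverse x y xy≈1 = record
    { to        = x *_
    ; from      = y *_
    ; to-cong   = *-congˡ
    ; from-cong = *-congˡ
    ; inverse   = (λ eq → trans (*-congˡ eq) (cancel xy≈1 _))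
                , (λ eq → trans (*-congˡ eq) (cancel (trans (*-comm y x) xy≈1) _))
    }
    where
    cancel : ∀ {v w} → v * w ≈ 1# → ∀ z → v * (w * z) ≈ z
    cancel vw≈1 z = trans (sym (*-assoc _ _ z)) (trans (*-congʳ vw≈1) (*-identityˡ z))

  -- The factor `x` in front fills the gap left by the entry 1 at `i₀`, so no exponent `m - 1` has
  -- to appear.
  *-product-constant : ∀ {m x} (t : Vector Carrier m) i₀ → t i₀ ≈ 1# →
                       (∀ i → ¬ i ≡ i₀ → t i ≈ x) → x * product t ≈ x ^ m
  *-product-constant {suc m} {x} t i₀ tᵢ₀≈1 t≈x = *-congˡ (begin
    product t                                  ≈⟨ sum-remove {i = i₀} t ⟩
    t i₀ * product (λ i → t (punchIn i₀ i))    ≈⟨ *-cong tᵢ₀≈1 (sum-cong-≋ λ i → t≈x _ (Fin.punchInᵢ≢i i₀ i)) ⟩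
    1# * product {m} (λ _ → x)                 ≈⟨ *-identityˡ _ ⟩
    product {m} (λ _ → x)                      ≈⟨ sum-replicate m ⟩
    x ^ m                                      ∎)

  -- Multiplication by x permutes the factors of the product of all nonzero
  -- elements; to index it by Fin n, the factor at 0 is replaced by 1.
  product-caseZero : ∀ {x} → ¬ x ≈ 0# → product (caseZero 1# x ∘ from) ≈ 1#
  product-caseZero {x} x≉0 = begin
    X                ≈⟨ *-identityʳ X ⟨
    X * 1#           ≈⟨ *-congˡ A*B≈1 ⟨
    X * (A * B)      ≈⟨ *-assoc X A B ⟨
    X * A * B        ≈⟨ *-congʳ A≈X*A ⟨
    A * B            ≈⟨ A*B≈1 ⟩
    1#               ∎
    where
    unit : Carrier → Carrier
    unit y = caseZero 1# y y

    unit-cong : ∀ {y z} → y ≈ z → unit y ≈ unit z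
    unit-cong {y} {z} y≈z with z ≟ 0#
    ... | yes z≈0 = caseZero-≈0 1# y (trans y≈z z≈0)
    ... | no  z≉0 = trans (caseZero-≉0 1# y (z≉0 ∘ trans (sym y≈z))) y≈z

    unit≉0 : ∀ y → ¬ unit y ≈ 0#
    unit≉0 y with y ≟ 0#
    ... | yes _   = 1≉0
    ... | no  y≉0 = y≉0

    unit-x* : ∀ y → unit (x * y) ≈ caseZero 1# x y * unit y
    unit-x* y with y ≟ 0#
    ... | yes y≈0 = trans (caseZero-≈0 1# (x * y) (trans (*-congˡ y≈0) (zeroʳ x)))
                          (sym (*-identityˡ 1#))
    ... | no  y≉0 = caseZero-≉0 1# (x * y) λ xy≈0 → y≉0 (noZeroDivisors xy≈0 x≉0)

    -- `X` is the power of `x` with exponent `n - 1`, and `A` is the product of the nonzero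
    -- elements; `A` is invertible, so it cancels from `A ≈ X * A`.
    X = product (caseZero 1# x ∘ from)
    A = product (unit ∘ from)

    A≉0 : ¬ A ≈ 0#
    A≉0 A≈0 = let i , eq = product≈0⇒∃≈0 (unit ∘ from) A≈0 in unit≉0 (from i) eq

    B = proj₁ (inverse A A≉0)
    A*B≈1 = proj₂ (inverse A A≉0)

    A≈X*A : A ≈ X * A
    A≈X*A = let y , xy≈1 = inverse x x≉0 in begin
      A                                         ≈⟨ sum-reindex order *-commutativeMonoid unit unit-cong (*-inverse x y xy≈1) ⟩
      product (λ i → unit (x * from i))         ≈⟨ sum-cong-≋ (unit-x* ∘ from) ⟩
      product (λ i → caseZero 1# x (from i) * unit (from i))
        ≈⟨ ∑-distrib-+ (caseZero 1# x ∘ from) (unit ∘ from) ⟩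
      X * A                                     ∎

  -- Split off one factor `x`: the remaining product is 1 when `x` is nonzero, and for `x` zero both
  -- sides vanish.
  x^order≈x : ∀ x → x ^ n ≈ x
  x^order≈x x = begin
    x ^ n          ≈⟨ *-product-constant t (to 0#) (caseZero-≈0 1# x (strictlyInverseʳ 0#)) t≈x ⟨
    x * product t  ≈⟨ x*∏≈x ⟩
    x              ∎
    where
    t = caseZero 1# x ∘ from

    t≈x : ∀ i → ¬ i ≡ to 0# → t i ≈ x
    t≈x i i≢ = caseZero-≉0 1# x λ eq → i≢ (≡.trans (≡.sym (strictlyInverseˡ i)) (to-cong eq))

    x*∏≈x : x * product t ≈ x
    x*∏≈x with x ≟ 0#
    ... | yes x≈0 = trans (*-congʳ x≈0) (trans (zeroˡ _) (sym x≈0))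
    ... | no  x≉0 = trans (*-congˡ (product-caseZero x≉0)) (*-identityʳ x)

-- Conjugation on the quadratic extension: fixed field and additivity.

module Conjugation {q : ℕ} {c₁ ℓ₁ ℓ₁′ c₂ ℓ₂ ℓ₂′ : Level}
  (E : QuadraticExtension q c₁ ℓ₁ ℓ₁′ c₂ ℓ₂ ℓ₂′) where

  open QuadraticExtension E
  open CommutativeRing (fieldCommutativeRing 𝔽q²) hiding (zero)
  open Exp commutativeSemiring using (^-distrib-*; ^-assocʳ; ^-homo-*)
  open RingProperties ring
  open SetoidReasoning setoid
  open SemiringSolver commutativeSemiring using (solve; _:+_; _:*_; _:=_)
  open Sum *-commutativeMonoid using (sum-cong-≋) renaming (sum to product)
  private
    module Fq  = FiniteField 𝔽q 𝔽q-order
    module Fq² = FiniteField 𝔽q² 𝔽q²-order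
    module ι   = IsRingMonomorphism ι-mono
  open Fq² using (_≟_; noZeroDivisors)
  open Inverse 𝔽q-order using (from; to-cong; strictlyInverseˡ)
  open MonicPolynomials (fieldCommutativeRing 𝔽q²) noZeroDivisors
    using (x^n-x-split)

  bar : Carrier → Carrier
  bar x = x ^ q

  bar-cong : ∀ {x y} → x ≈ y → bar x ≈ bar y
  bar-cong = ^-congˡ q

  bar-* : ∀ x y → bar (x * y) ≈ bar x * bar y
  bar-* x y = ^-distrib-* x y q

  bar-involutive : ∀ x → bar (bar x) ≈ x
  bar-involutive x = begin
    (x ^ q) ^ q       ≈⟨ ^-assocʳ x q q ⟩
    x ^ (q ℕ.* q)     ≡⟨ ≡.cong (λ k → x ^ (q ℕ.* k)) (ℕ.*-identityʳ q) ⟨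
    x ^ (q ℕ.^ 2)     ≈⟨ Fq².x^order≈x x ⟩
    x                 ∎

  -- Fermat's little theorem in 𝔽q, carried along `ι`.
  bar-ι : ∀ y → bar (ι y) ≈ ι y
  bar-ι y = trans (sym (ι-^ q)) (ι.⟦⟧-cong (Fq.x^order≈x y))
    where
    open Exp 𝔽q.commutativeSemiring using () renaming (_^_ to _^ₛ_)
    ι-^ : ∀ k → ι (y ^ₛ k) ≈ ι y ^ k
    ι-^ zero    = ι.1#-homo
    ι-^ (suc k) = trans (ι.*-homo y (y ^ₛ k)) (*-congˡ (ι-^ k))

  ∈𝔽q⇒bar-fixed : ∀ {x} → x ∈𝔽q → bar x ≈ x
  ∈𝔽q⇒bar-fixed (y , ιy≈x) = trans (bar-cong (sym ιy≈x)) (trans (bar-ι y) ιy≈x)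

  -- Zero lies in 𝔽q and is therefore fixed; this way the exponent `q` need not be split to see that
  -- it is positive.
  bar-≈0 : ∀ {x} → x ≈ 0# → bar x ≈ 0#
  bar-≈0 x≈0 = trans (∈𝔽q⇒bar-fixed (𝔽q.0# , trans ι.0#-homo (sym x≈0))) x≈0

  bar-1 : bar 1# ≈ 1#
  bar-1 = ∈𝔽q⇒bar-fixed (𝔽q.1# , ι.1#-homo)

  -- The elements of 𝔽q are `q` distinct roots of a monic polynomial of degree `q`.
  bar-x-x≈∏ : ∀ x → bar x - x ≈ product (λ i → x - ι (from i))
  bar-x-x≈∏ = x^n-x-split Fq.2≤order (ι ∘ from) ι∘from-injective (bar-ι ∘ from)
    where
    ι∘from-injective : ∀ {i j} → ι (from i) ≈ ι (from j) → i ≡ j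
    ι∘from-injective {i} {j} eq = ≡.trans (≡.sym (strictlyInverseˡ i))
      (≡.trans (to-cong (ι.injective eq)) (strictlyInverseˡ j))

  -- For a fixed `x` the product over 𝔽q vanishes, hence so does one factor, and that factor names
  -- the element of 𝔽q.
  bar-fixed⇒∈𝔽q : ∀ {x} → bar x ≈ x → x ∈𝔽q
  bar-fixed⇒∈𝔽q {x} eq =
    let i , x-ιi≈0 = Fq².product≈0⇒∃≈0 _ (trans (sym (bar-x-x≈∏ x)) (x≈y⇒x∙y⁻¹≈ε eq))
    in from i , sym (x∙y⁻¹≈ε⇒x≈y _ _ x-ιi≈0)

  -- y ↦ y − 1 permutes 𝔽q, so the product over 𝔽q of x + 1 − a = x − (a − 1)
  -- is that of x − a.
  bar-+1 : ∀ x → bar (x + 1#) ≈ bar x + 1#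
  bar-+1 x = begin
    bar (x + 1#)                                        ≈⟨ //-rightDividesˡ (x + 1#) _ ⟨
    bar (x + 1#) - (x + 1#) + (x + 1#)                  ≈⟨ +-congʳ (bar-x-x≈∏ (x + 1#)) ⟩
    product (λ i → x + 1# - ι (from i)) + (x + 1#)      ≈⟨ +-congʳ (sum-cong-≋ λ i → shift (from i)) ⟩
    product (λ i → x - ι (from i 𝔽q.- 𝔽q.1#)) + (x + 1#)
      ≈⟨ +-congʳ (sum-reindex 𝔽q-order *-commutativeMonoid (λ y → x - ι y)
           (λ eq → +-congˡ (-‿cong (ι.⟦⟧-cong eq))) pred) ⟨
    product (λ i → x - ι (from i)) + (x + 1#)           ≈⟨ +-congʳ (bar-x-x≈∏ x) ⟨
    bar x - x + (x + 1#)                                ≈⟨ +-assoc _ x 1# ⟨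
    bar x - x + x + 1#                                  ≈⟨ +-congʳ (//-rightDividesˡ x (bar x)) ⟩
    bar x + 1#                                          ∎
    where
    module RP = RingProperties 𝔽q.ring

    pred : Inverse 𝔽q.setoid 𝔽q.setoid
    pred = record
      { to        = 𝔽q._- 𝔽q.1#
      ; from      = 𝔽q._+ 𝔽q.1#
      ; to-cong   = 𝔽q.+-congʳ
      ; from-cong = 𝔽q.+-congʳ
      ; inverse   = (λ eq → 𝔽q.trans (𝔽q.+-congʳ eq) (RP.//-rightDividesʳ 𝔽q.1# _))
                  , (λ eq → 𝔽q.trans (𝔽q.+-congʳ eq) (RP.//-rightDividesˡ 𝔽q.1# _))
      }

    shift : ∀ y → x + 1# - ι y ≈ x - ι (y 𝔽q.- 𝔽q.1#)
    shift y = begin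
      x + 1# - ι y                  ≈⟨ +-assoc x 1# (- ι y) ⟩
      x + (1# - ι y)                ≈⟨ +-congˡ (⁻¹-anti-homo-// (ι y) 1#) ⟨
      x - (ι y - 1#)                ≈⟨ +-congˡ (-‿cong (+-congˡ (-‿cong ι.1#-homo))) ⟨
      x - (ι y - ι 𝔽q.1#)           ≈⟨ +-congˡ (-‿cong (+-congˡ (ι.-‿homo 𝔽q.1#))) ⟨
      x - (ι y + ι (𝔽q.- 𝔽q.1#))    ≈⟨ +-congˡ (-‿cong (ι.+-homo y (𝔽q.- 𝔽q.1#))) ⟨
      x - ι (y 𝔽q.- 𝔽q.1#)          ∎

  -- For nonzero `y` with inverse `z`, write the sum as `(x * z + 1#) * y`; multiplicativity of
  -- `bar` then reduces the claim to `bar-+1`.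
  bar-+ : ∀ x y → bar (x + y) ≈ bar x + bar y
  bar-+ x y with y ≟ 0#
  ... | yes y≈0 = begin
    bar (x + y)      ≈⟨ bar-cong (trans (+-congˡ y≈0) (+-identityʳ x)) ⟩
    bar x            ≈⟨ +-identityʳ (bar x) ⟨
    bar x + 0#       ≈⟨ +-congˡ (bar-≈0 y≈0) ⟨
    bar x + bar y    ∎
  ... | no y≉0 = begin
    bar (x + y)                    ≈⟨ bar-cong (+-cong xzy≈x (*-identityˡ y)) ⟨
    bar (x * z * y + 1# * y)       ≈⟨ bar-cong (distribʳ y (x * z) 1#) ⟨
    bar ((x * z + 1#) * y)         ≈⟨ bar-* (x * z + 1#) y ⟩
    bar (x * z + 1#) * bar y       ≈⟨ *-congʳ (bar-+1 (x * z)) ⟩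
    (bar (x * z) + 1#) * bar y     ≈⟨ distribʳ (bar y) (bar (x * z)) 1# ⟩
    bar (x * z) * bar y + 1# * bar y
      ≈⟨ +-cong (trans (sym (bar-* (x * z) y)) (bar-cong xzy≈x)) (*-identityˡ (bar y)) ⟩
    bar x + bar y                  ∎
    where
    z = proj₁ (Fq².inverse y y≉0)
    xzy≈x : x * z * y ≈ x
    xzy≈x = begin
      x * z * y      ≈⟨ *-assoc x z y ⟩
      x * (z * y)    ≈⟨ *-congˡ (*-comm z y) ⟩
      x * (y * z)    ≈⟨ *-congˡ (proj₂ (Fq².inverse y y≉0)) ⟩
      x * 1#         ≈⟨ *-identityʳ x ⟩
      x              ∎

  bar-neg : ∀ x → bar (- x) ≈ - bar x
  bar-neg x = +-inverseˡ-unique _ _ (trans (sym (bar-+ (- x) x)) (bar-≈0 (-‿inverseˡ x)))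

  -- The trace and its linearity over 𝔽q.

  -- Unfolds to the same term as `Tr` over 𝔽q², so that `eval-f` applies directly.
  T : Carrier → Carrier
  T x = x + bar x

  T-cong : ∀ {x y} → x ≈ y → T x ≈ T y
  T-cong eq = +-cong eq (bar-cong eq)

  bar-T : ∀ x → bar (T x) ≈ T x
  bar-T x = begin
    bar (x + bar x)        ≈⟨ bar-+ x (bar x) ⟩
    bar x + bar (bar x)    ≈⟨ +-congˡ (bar-involutive x) ⟩
    bar x + x              ≈⟨ +-comm (bar x) x ⟩
    x + bar x              ∎

  T-+ : ∀ x y → T (x + y) ≈ T x + T y
  T-+ x y = trans (+-congˡ (bar-+ x y))
    (solve 4 (λ x y x̄ ȳ → (x :+ y) :+ (x̄ :+ ȳ) := (x :+ x̄) :+ (y :+ ȳ)) refl x y (bar x) (bar y))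

  -- Scalars from 𝔽q are given as fixed points of `bar`, which spares carrying preimages under `ι`.
  T-*fixed : ∀ x {w} → bar w ≈ w → T (x * w) ≈ T x * w
  T-*fixed x {w} w̄≈w = begin
    x * w + bar (x * w)      ≈⟨ +-congˡ (bar-* x w) ⟩
    x * w + bar x * bar w    ≈⟨ +-congˡ (*-congˡ w̄≈w) ⟩
    x * w + bar x * w        ≈⟨ distribʳ w x (bar x) ⟨
    T x * w                  ∎

  T-≈0 : ∀ {x} → x ≈ 0# → T x ≈ 0#
  T-≈0 x≈0 = trans (+-cong x≈0 (bar-≈0 x≈0)) (+-identityˡ 0#)

  bar-fixed-* : ∀ {x y} → bar x ≈ x → bar y ≈ y → bar (x * y) ≈ x * y
  bar-fixed-* {x} {y} x̄≈x ȳ≈y = trans (bar-* x y) (*-cong x̄≈x ȳ≈y)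

  bar-fixed-neg : ∀ {x} → bar x ≈ x → bar (- x) ≈ - x
  bar-fixed-neg {x} x̄≈x = trans (bar-neg x) (-‿cong x̄≈x)

  -- Permutation criterion: the trace of γ vanishes.

  -- The norm `bar x * x` is fixed by conjugation and so enters the trace twice, which completes the
  -- sum of the squares of `x` and `bar x` to the square of `T x`.
  eval-f≈ : ∀ γ x → eval (f γ) x ≈ x + γ * (T x * T x)
  eval-f≈ γ x = trans (eval-f γ x) (+-congˡ (*-congˡ (begin
    T (x ^ 2 + x ^ (q ℕ.+ 1))        ≈⟨ T-cong (+-cong x²≈ x^[q+1]≈) ⟩
    T (x * x + bar x * x)            ≈⟨ T-+ (x * x) (bar x * x) ⟩
    T (x * x) + T (bar x * x)        ≈⟨ +-cong (+-congˡ (bar-* x x))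
      (+-congˡ (trans (bar-* (bar x) x) (*-congʳ (bar-involutive x)))) ⟩
    (x * x + bar x * bar x) + (bar x * x + x * bar x)
      ≈⟨ solve 2 (λ x x̄ → (x :* x :+ x̄ :* x̄) :+ (x̄ :* x :+ x :* x̄) :=
                          (x :+ x̄) :* (x :+ x̄)) refl x (bar x) ⟩
    T x * T x                        ∎)))
    where
    x²≈ : x ^ 2 ≈ x * x
    x²≈ = *-congˡ (*-identityʳ x)
    x^[q+1]≈ : x ^ (q ℕ.+ 1) ≈ bar x * x
    x^[q+1]≈ = trans (^-homo-* x q 1) (*-congˡ (*-identityʳ x))

  Tγ≈0⇒permutation : ∀ {γ} → T γ ≈ 0# → IsPermutationPolynomial (f γ)
  Tγ≈0⇒permutation {γ} Tγ≈0 = injective , surjective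
    where
    T-γ*fixed : ∀ {w} → bar w ≈ w → T (γ * w) ≈ 0#
    T-γ*fixed {w} w̄≈w = trans (T-*fixed γ w̄≈w) (trans (*-congʳ Tγ≈0) (zeroˡ w))

    T-+γ*fixed : ∀ x {w} → bar w ≈ w → T (x + γ * w) ≈ T x
    T-+γ*fixed x w̄≈w = trans (T-+ x _) (trans (+-congˡ (T-γ*fixed w̄≈w)) (+-identityʳ (T x)))

    T² : Carrier → Carrier
    T² x = T x * T x

    bar-T² : ∀ x → bar (T² x) ≈ T² x
    bar-T² x = bar-fixed-* (bar-T x) (bar-T x)

    T²-cong : ∀ {x y} → T x ≈ T y → T² x ≈ T² y
    T²-cong eq = *-cong eq eq

    T-f : ∀ x → T (eval (f γ) x) ≈ T x
    T-f x = trans (T-cong (eval-f≈ γ x)) (T-+γ*fixed x (bar-T² x))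

    injective : ∀ {x y} → eval (f γ) x ≈ eval (f γ) y → x ≈ y
    injective {x} {y} fx≈fy = +-cancelʳ (γ * T² x) x y (begin
      x + γ * T² x      ≈⟨ eval-f≈ γ x ⟨
      eval (f γ) x      ≈⟨ fx≈fy ⟩
      eval (f γ) y      ≈⟨ eval-f≈ γ y ⟩
      y + γ * T² y      ≈⟨ +-congˡ (*-congˡ (T²-cong Ty≈Tx)) ⟩
      y + γ * T² x      ∎)
      where
      Ty≈Tx : T y ≈ T x
      Ty≈Tx = trans (sym (T-f y)) (trans (T-cong (sym fx≈fy)) (T-f x))

    surjective : ∀ y → ∃ λ x → ∀ {z} → z ≈ x → eval (f γ) z ≈ y
    surjective y = x , λ {z} z≈x → begin
      eval (f γ) z                      ≈⟨ eval-f≈ γ z ⟩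
      z + γ * T² z                      ≈⟨ +-cong z≈x (*-congˡ (T²-cong (trans (T-cong z≈x) Tx≈Ty))) ⟩
      y + γ * - T² y + γ * T² y         ≈⟨ +-assoc _ _ _ ⟩
      y + (γ * - T² y + γ * T² y)       ≈⟨ +-congˡ (distribˡ γ _ _) ⟨
      y + γ * (- T² y + T² y)           ≈⟨ +-congˡ (*-congˡ (-‿inverseˡ (T² y))) ⟩
      y + γ * 0#                        ≈⟨ +-congˡ (zeroʳ γ) ⟩
      y + 0#                            ≈⟨ +-identityʳ y ⟩
      y                                 ∎
      where
      -- The correction has trace zero, so `x` and `y` have the same trace and `f γ` adds back
      -- exactly what was subtracted. The sign sits on the fixed factor to match `T-+γ*fixed`.
      x = y + γ * - T² y
      Tx≈Ty : T x ≈ T y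
      Tx≈Ty = T-+γ*fixed y (bar-fixed-neg (bar-T² y))

  permutation⇒Tγ≈0 : ∀ {γ} → IsPermutationPolynomial (f γ) → T γ ≈ 0#
  permutation⇒Tγ≈0 {γ} (injective , _) with T γ ≟ 0#
  ... | yes t≈0 = t≈0
  ... | no  t≉0 = ⊥-elim (Fq².1≉0 (begin
    1#              ≈⟨ ti≈1 ⟨
    t * i           ≈⟨ *-congˡ i≈0 ⟩
    t * 0#          ≈⟨ zeroʳ t ⟩
    0#              ∎))
    where
    t = T γ
    i = proj₁ (Fq².inverse t t≉0)
    ti≈1 = proj₂ (Fq².inverse t t≉0)

    -- The inverse of a fixed element is fixed: `i * (t * bar i)` equals `bar i` by `t * i ≈ 1#`,
    -- and equals `i` by conjugating that equation.
    bar-i : bar i ≈ i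
    bar-i = begin
      bar i                  ≈⟨ *-identityˡ (bar i) ⟨
      1# * bar i             ≈⟨ *-congʳ ti≈1 ⟨
      t * i * bar i          ≈⟨ solve 3 (λ t i ī → t :* i :* ī := i :* (t :* ī)) refl t i (bar i) ⟩
      i * (t * bar i)        ≈⟨ *-congˡ (*-congʳ (bar-T γ)) ⟨
      i * (bar t * bar i)    ≈⟨ *-congˡ (trans (sym (bar-* t i)) (trans (bar-cong ti≈1) bar-1)) ⟩
      i * 1#                 ≈⟨ *-identityʳ i ⟩
      i                      ∎

    -- Chosen so that `γ * w` has trace `- i`, whose square cancels `w` in the value of `f γ`.
    w = - (i * i)

    Tγw≈-i : T (γ * w) ≈ - i
    Tγw≈-i = begin
      T (γ * w)        ≈⟨ T-*fixed γ (bar-fixed-neg (bar-fixed-* bar-i bar-i)) ⟩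
      t * - (i * i)    ≈⟨ -‿distribʳ-* t (i * i) ⟨
      - (t * (i * i))  ≈⟨ -‿cong (*-assoc t i i) ⟨
      - (t * i * i)    ≈⟨ -‿cong (trans (*-congʳ ti≈1) (*-identityˡ i)) ⟩
      - i              ∎

    -i*-i≈i*i : - i * - i ≈ i * i
    -i*-i≈i*i = begin
      - i * - i      ≈⟨ -‿distribˡ-* i (- i) ⟨
      - (i * - i)    ≈⟨ -‿cong (-‿distribʳ-* i i) ⟨
      - - (i * i)    ≈⟨ -‿involutive (i * i) ⟩
      i * i          ∎

    γw≈0 : γ * w ≈ 0#
    γw≈0 = injective (begin
      eval (f γ) (γ * w)                    ≈⟨ eval-f≈ γ (γ * w) ⟩
      γ * w + γ * (T (γ * w) * T (γ * w))   ≈⟨ +-congˡ (*-congˡ (trans (*-cong Tγw≈-i Tγw≈-i) -i*-i≈i*i)) ⟩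
      γ * w + γ * (i * i)                   ≈⟨ distribˡ γ w (i * i) ⟨
      γ * (w + i * i)                       ≈⟨ *-congˡ (-‿inverseˡ (i * i)) ⟩
      γ * 0#                                ≈⟨ zeroʳ γ ⟩
      0#                                    ≈⟨ zeroʳ γ ⟨
      γ * 0#                                ≈⟨ *-congˡ (trans (*-congʳ (T-≈0 refl)) (zeroˡ (T 0#))) ⟨
      γ * (T 0# * T 0#)                     ≈⟨ +-identityˡ _ ⟨
      0# + γ * (T 0# * T 0#)                ≈⟨ eval-f≈ γ 0# ⟨
      eval (f γ) 0#                         ∎)

    -- Taking the trace of `γ * w ≈ 0#` gives `- i ≈ 0#`, which contradicts the invertibility of
    -- `i`.
    i≈0 : i ≈ 0#
    i≈0 = begin
      i                ≈⟨ -‿involutive i ⟨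
      - - i            ≈⟨ -‿cong Tγw≈-i ⟨
      - T (γ * w)      ≈⟨ -‿cong (T-≈0 γw≈0) ⟩
      - 0#             ≈⟨ -0#≈0# ⟩
      0#               ∎

  -- The square root of a non-residue and membership of αγ in 𝔽q.

  module _ {u : 𝔽q.Carrier} (u-nonresidue : QuadraticNonResidue 𝔽q u)
           {α : Carrier} (α²≈u : α ^ 2 ≈ ι u) where

    α∉𝔽q : ¬ α ∈𝔽q
    α∉𝔽q (y , ιy≈α) = u-nonresidue (y , ι.injective (begin
      ι (y 𝔽q.* (y 𝔽q.* 𝔽q.1#))      ≈⟨ ι.⟦⟧-cong (𝔽q.*-congˡ (𝔽q.*-identityʳ y)) ⟩
      ι (y 𝔽q.* y)                   ≈⟨ ι.*-homo y y ⟩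
      ι y * ι y                      ≈⟨ *-cong ιy≈α (trans ιy≈α (sym (*-identityʳ α))) ⟩
      α ^ 2                          ≈⟨ α²≈u ⟩
      ι u                            ∎))

    α≉0 : ¬ α ≈ 0#
    α≉0 α≈0 = α∉𝔽q (𝔽q.0# , trans ι.0#-homo (sym α≈0))

    -- Both `α` and `bar α` square to `ι u`, so the product of their difference and their sum is
    -- zero; the difference is nonzero because `α` lies outside the fixed field.
    bar-α : bar α ≈ - α
    bar-α = +-inverseˡ-unique _ _ (noZeroDivisors [ᾱ-α][ᾱ+α]≈0
      (α∉𝔽q ∘ bar-fixed⇒∈𝔽q ∘ x∙y⁻¹≈ε⇒x≈y _ _))
      where
      α*α≈u : α * α ≈ ι u
      α*α≈u = trans (*-congˡ (sym (*-identityʳ α))) α²≈u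

      ᾱ*ᾱ≈α*α : bar α * bar α ≈ α * α
      ᾱ*ᾱ≈α*α = begin
        bar α * bar α    ≈⟨ bar-* α α ⟨
        bar (α * α)      ≈⟨ bar-cong α*α≈u ⟩
        bar (ι u)        ≈⟨ bar-ι u ⟩
        ι u              ≈⟨ α*α≈u ⟨
        α * α            ∎

      [ᾱ-α][ᾱ+α]≈0 : (bar α - α) * (bar α + α) ≈ 0#
      [ᾱ-α][ᾱ+α]≈0 = begin
        (bar α - α) * (bar α + α)
          ≈⟨ solve 3 (λ ᾱ α -α → (ᾱ :+ -α) :* (ᾱ :+ α) := ᾱ :* ᾱ :+ (ᾱ :* (α :+ -α) :+ -α :* α))
               refl (bar α) α (- α) ⟩
        bar α * bar α + (bar α * (α - α) + - α * α)
          ≈⟨ +-cong ᾱ*ᾱ≈α*α (+-cong (trans (*-congˡ (-‿inverseʳ α)) (zeroʳ (bar α))) (sym (-‿distribˡ-* α α))) ⟩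
        α * α + (0# - α * α)    ≈⟨ +-congˡ (+-identityˡ _) ⟩
        α * α - α * α           ≈⟨ -‿inverseʳ (α * α) ⟩
        0#                      ∎

    -- With `α` in front and the sign on `bar γ`, being fixed compares `γ` with `- bar γ`, which is
    -- the vanishing of `T γ`.
    bar-αγ : ∀ γ → bar (α * γ) ≈ α * - bar γ
    bar-αγ γ = begin
      bar (α * γ)      ≈⟨ bar-* α γ ⟩
      bar α * bar γ    ≈⟨ *-congʳ bar-α ⟩
      - α * bar γ      ≈⟨ -‿distribˡ-* α (bar γ) ⟨
      - (α * bar γ)    ≈⟨ -‿distribʳ-* α (bar γ) ⟩
      α * - bar γ      ∎

    Tγ≈0⇒αγ∈𝔽q : ∀ {γ} → T γ ≈ 0# → α * γ ∈𝔽q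
    Tγ≈0⇒αγ∈𝔽q {γ} Tγ≈0 = bar-fixed⇒∈𝔽q
      (trans (bar-αγ γ) (*-congˡ (sym (+-inverseˡ-unique γ (bar γ) Tγ≈0))))

    -- The multiple `α * T γ` vanishes once `α * γ` is replaced by its conjugate, and the nonzero
    -- `α` cancels.
    αγ∈𝔽q⇒Tγ≈0 : ∀ {γ} → α * γ ∈𝔽q → T γ ≈ 0#
    αγ∈𝔽q⇒Tγ≈0 {γ} αγ∈𝔽q = noZeroDivisors (begin
      α * (γ + bar γ)                  ≈⟨ distribˡ α γ (bar γ) ⟩
      α * γ + α * bar γ                ≈⟨ +-congʳ (∈𝔽q⇒bar-fixed αγ∈𝔽q) ⟨
      bar (α * γ) + α * bar γ          ≈⟨ +-congʳ (bar-αγ γ) ⟩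
      α * - bar γ + α * bar γ          ≈⟨ distribˡ α (- bar γ) (bar γ) ⟨
      α * (- bar γ + bar γ)            ≈⟨ *-congˡ (-‿inverseˡ (bar γ)) ⟩
      α * 0#                           ≈⟨ zeroʳ α ⟩
      0#                               ∎) α≉0

corollary3p1 : {c₁ ℓ₁ ℓ₁′ c₂ ℓ₂ ℓ₂′ : Level} (q : ℕ) → OddPrimePower q →
    (E : QuadraticExtension q c₁ ℓ₁ ℓ₁′ c₂ ℓ₂ ℓ₂′) →
    let open QuadraticExtension E in
    (u : 𝔽q.Carrier) → QuadraticNonResidue 𝔽q u →
    (α : 𝔽q².Carrier) → α ^ 2 𝔽q².≈ ι u →
    (γ : 𝔽q².Carrier) →
    IsPermutationPolynomial (f γ) ⇔ (α 𝔽q².* γ) ∈𝔽q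
corollary3p1 q _ E u u-nonresidue α α²≈u γ = mk⇔
  (Tγ≈0⇒αγ∈𝔽q u-nonresidue α²≈u ∘ permutation⇒Tγ≈0)
  (Tγ≈0⇒permutation ∘ αγ∈𝔽q⇒Tγ≈0 u-nonresidue α²≈u)
  where open Conjugation E
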